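{- The classical DPLL transition relation $\Longrightarrow$ on states is well-founded, where a state $s'$ is regarded as below a state $s$ when $s\Longrightarrow s'$; that is, every state is accessible for this ordering (in particular every sequence of transitions $s_0\Longrightarrow s_1\Longrightarrow\cdots$ terminates).
   Context: Fix a finite set $P$ of atoms. A literal is an atom $p\in P$ or its negation $\neg p$, with $\neg\neg p=p$. A clause is a finite list of literals, read as their disjunction; a formula (CNF) is a finite list of clauses, read as their conjunction. A partial assignment is an arbitrary finite list of literals, each annotated either as a decision literal (written $l^d$) or as a propagated literal (written $l$). New literals are appended on the right, and $mn$ denotes concatenation. Evaluation takes values in $\{T,F,U\}$ and ignores annotations; the rightmost occurrence of an atom takes precedence: $[\![l]\!]_m=T$ if the rightmost occurrence in $m$ of the atom of $l$ is as $l$, $F$ if it is as $\neg l$, and $U$ if the atom does not occur in $m$. For a clause $c$: $[\![c]\!]_m=T$ if some literal of $c$ evaluates to $T$, $F$ if all literals of $c$ evaluate to $F$, else $U$. "True/false/undefined in $m$" means value $T/F/U$. A state is either the distinguished state $\mathtt{fail}$ or a pair $m\parallel f$ of a partial assignment and a formula. The classical DPLL system is the relation $\Longrightarrow$ on states given by the rules (order within clauses and formulas being irrelevant for reading $c\lor l$, $f\land c$): UnitPropagate: $m\parallel f\land(c\lor l)\Longrightarrow m\,l\parallel f\land(c\lor l)$ if $c$ is false in $m$ and $l$ is undefined in $m$. Decide: $m\parallel f\Longrightarrow m\,l^d\parallel f$ if $l$ or $\neg l$ occurs in a clause of $f$ and $l$ is undefined in $m$. Fail: $m\parallel f\land c\Longrightarrow\mathtt{fail}$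 if $c$ is false in $m$ and $m$ contains no decision literals. Backtrack: $m\,l^d\,n\parallel f\land c\Longrightarrow m\,\neg l\parallel f\land c$ if $c$ is false in $m\,l^d\,n$ and $n$ contains no decision literals (the new $\neg l$ is propagated). Pure: $m\parallel f\Longrightarrow m\,l\parallel f$ if $l$ occurs in a clause of $f$, $\neg l$ occurs in no clause of $f$, and $l$ is undefined in $m$. Accessibility is the inductive predicate: $s$ is accessible if every element below $s$ is accessible. A relation is well-founded if every element is accessible. -}

module Defs where

open import Data.Bool.Base using (if_then_else_)
open import Data.Fin.Base using (Fin)
import Data.Fin.Properties as Fin
open import Data.List.Base using (List; []; _∷_; _++_; _∷ʳ_)
open import Data.List.Membership.Propositional using (_∈_; _∉_)
open import Data.List.Relation.Unary.All using (all?)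
open import Data.List.Relation.Unary.Any using (Any; any?)
open import Data.List.Relation.Binary.Permutation.Propositional using (_↭_)
open import Data.Nat.Base using (ℕ)
open import Data.Sum.Base using (_⊎_)
open import Function.Base using (flip)
open import Level using (0ℓ)
open import Relation.Binary.Core using (Rel)
open import Relation.Binary.Definitions using (DecidableEquality)
open import Relation.Binary.PropositionalEquality.Core using (_≡_; refl; cong)
open import Relation.Nullary.Decidable using (yes; no; ⌊_⌋; map′)
open import Relation.Nullary.Negation.Core using (¬_)

private
  variable
    n : ℕ

-- The finite set of atoms is Fin n.
data Literal (n : ℕ) : Set where
  pos neg : Fin n → Literal n

infix 9 ~_

~_ : Literal n → Literal n
~ pos p = neg p
~ neg p = pos p

infix 4 _≟ˡ_

_≟ˡ_ : DecidableEquality (Literal n)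
pos p ≟ˡ pos q = map′ (cong pos) (λ { refl → refl }) (p Fin.≟ q)
pos p ≟ˡ neg q = no λ ()
neg p ≟ˡ pos q = no λ ()
neg p ≟ˡ neg q = map′ (cong neg) (λ { refl → refl }) (p Fin.≟ q)

Clause : ℕ → Set
Clause n = List (Literal n)

Formula : ℕ → Set
Formula n = List (Clause n)

infix 4 _OccursIn_

_OccursIn_ : Literal n → Formula n → Set
l OccursIn f = Any (l ∈_) f

data Annotated (n : ℕ) : Set where
  decided propagated : Literal n → Annotated n

literal : Annotated n → Literal n
literal (decided l)    = l
literal (propagated l) = l

-- The head of the list is the leftmost, i.e. oldest, entry.  Nothing prevents
-- an atom from occurring several times, with either sign.
Assignment : ℕ → Set
Assignment n = List (Annotated n)

NoDecisions : Assignment n → Set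
NoDecisions m = ∀ l → decided l ∉ m

data Value : Set where
  T F U : Value

infix 4 _≟ᵛ_

_≟ᵛ_ : DecidableEquality Value
T ≟ᵛ T = yes refl
T ≟ᵛ F = no λ ()
T ≟ᵛ U = no λ ()
F ≟ᵛ T = no λ ()
F ≟ᵛ F = yes refl
F ≟ᵛ U = no λ ()
U ≟ᵛ T = no λ ()
U ≟ᵛ F = no λ ()
U ≟ᵛ U = yes refl

-- The tail is consulted before the head, so that the rightmost occurrence of
-- the atom of l decides.
evalLiteral : Literal n → Assignment n → Value
evalLiteral l []      = U
evalLiteral l (a ∷ m) with evalLiteral l m
... | T = T
... | F = F
... | U = if ⌊ literal a ≟ˡ l ⌋ then T
          else if ⌊ literal a ≟ˡ ~ l ⌋ then F
          else U

evalClause : Clause n → Assignment n → Value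
evalClause c m =
  if ⌊ any? (λ l → evalLiteral l m ≟ᵛ T) c ⌋ then T
  else if ⌊ all? (λ l → evalLiteral l m ≟ᵛ F) c ⌋ then F
  else U

infix 4.5 _∥_

data State (n : ℕ) : Set where
  fail : State n
  _∥_  : Assignment n → Formula n → State n

infix 4 _⟹_

-- A formula reads as "f ∧ c", up to order, when c is a member of it; a clause
-- reads as "c ∨ l", up to order, when it is a permutation of c ∷ʳ l.
data _⟹_ {n : ℕ} : Rel (State n) 0ℓ where

  unitPropagate : ∀ {m f d c l} →
    d ∈ f → d ↭ c ∷ʳ l →
    evalClause c m ≡ F → evalLiteral l m ≡ U →
    m ∥ f ⟹ m ∷ʳ propagated l ∥ f

  decide : ∀ {m f l} →
    l OccursIn f ⊎ ~ l OccursIn f →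
    evalLiteral l m ≡ U →
    m ∥ f ⟹ m ∷ʳ decided l ∥ f

  failure : ∀ {m f c} →
    c ∈ f → evalClause c m ≡ F → NoDecisions m →
    m ∥ f ⟹ fail

  backtrack : ∀ {m l k f c} →
    c ∈ f → evalClause c (m ++ decided l ∷ k) ≡ F → NoDecisions k →
    m ++ decided l ∷ k ∥ f ⟹ m ∷ʳ propagated (~ l) ∥ f

  pure : ∀ {m f l} →
    l OccursIn f → ¬ (~ l OccursIn f) →
    evalLiteral l m ≡ U →
    m ∥ f ⟹ m ∷ʳ propagated l ∥ f

-- t ⟸ s: the state t is below the state s.
infix 4 _⟸_

_⟸_ : Rel (State n) 0ℓ
_⟸_ = flip _⟹_

{-# OPTIONS --safe #-}

-- Weigh an assignment by the size of the search that may still follow it.  A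
-- position where u atoms are undefined gets the budget 3 ^ u; an assignment
-- weighs the budget at its end plus, for each decision l, the budget just after
-- l, which pays for exploring the branch ¬ l later.  Defining an atom divides
-- the budget by 3, and a decision claims only two of the three parts.  A
-- backtrack over l drops the positive weight of everything after l and starts
-- the branch ¬ l with the budget reserved for it.
module Submission where

open import Defs
open import Data.Fin.Base using (Fin)
open import Data.Fin.Subset using (Subset; ⊤; ∣_∣; _-_) renaming (_∈_ to _∈ˢ_)
open import Data.Fin.Subset.Properties using (∈⊤; x∈p∧x≢y⇒x∈p-y; x∈p⇒∣p-x∣<∣p∣)
open import Data.List.Base using ([]; _∷_; _++_; _∷ʳ_)
open import Data.Nat.Base using (ℕ; suc; _+_; _^_; _<_)
open import Data.Nat.Induction using (<-wellFounded)
open import Data.Nat.Properties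
  using (m^n>0; ^-monoʳ-≤; +-monoʳ-<; m<m+n; m≤m+n; m≤n+m; ≤-trans; ≤-<-trans; module ≤-Reasoning)
open import Data.Product.Base using (_×_; _,_; ∃)
open import Function.Base using (_on_)
open import Induction.InfiniteDescent using (InfiniteDescendingSequence; descent∧wf⇒empty)
open import Induction.WellFounded using (WellFounded; module Subrelation)
import Relation.Binary.Construct.On as On
open import Relation.Binary.Core using (Rel)
open import Relation.Binary.PropositionalEquality.Core using (_≡_; _≢_; refl; sym; cong)
open import Relation.Nullary.Decidable using (yes; no)
open import Relation.Nullary.Negation.Core using (¬_; contradiction)

private
  variable
    n : ℕ
    S : Subset n

atom : Literal n → Fin n
atom (pos p) = p
atom (neg p) = p

atom-~ : (l : Literal n) → atom (~ l) ≡ atom l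
atom-~ (pos p) = refl
atom-~ (neg p) = refl

≢∧≢~⇒atom≢ : (k l : Literal n) → k ≢ l → k ≢ ~ l → atom k ≢ atom l
≢∧≢~⇒atom≢ (pos p) (pos q) k≢l k≢~l p≡q = k≢l (cong pos p≡q)
≢∧≢~⇒atom≢ (pos p) (neg q) k≢l k≢~l p≡q = k≢~l (cong pos p≡q)
≢∧≢~⇒atom≢ (neg p) (pos q) k≢l k≢~l p≡q = k≢~l (cong neg p≡q)
≢∧≢~⇒atom≢ (neg p) (neg q) k≢l k≢~l p≡q = k≢l (cong neg p≡q)

-- The tail takes precedence, so `U` arises only if it leaves `l` undefined and the head then
-- matches neither `l` nor `~ l`.
undefined-∷⁻ : ∀ (l : Literal n) a m → evalLiteral l (a ∷ m) ≡ U →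
               atom (literal a) ≢ atom l × evalLiteral l m ≡ U
undefined-∷⁻ l a m eq with evalLiteral l m
undefined-∷⁻ l a m () | T
undefined-∷⁻ l a m () | F
... | U with literal a ≟ˡ l | literal a ≟ˡ ~ l
undefined-∷⁻ l a m () | U | yes _ | _
undefined-∷⁻ l a m () | U | no _ | yes _
... | no a≢l | no a≢~l = ≢∧≢~⇒atom≢ (literal a) l a≢l a≢~l , refl

budget : Subset n → ℕ
budget S = 3 ^ ∣ S ∣

budget>0 : (S : Subset n) → 0 < budget S
budget>0 S = m^n>0 3 ∣ S ∣

3^-double-< : ∀ {i j} → i < j → 3 ^ i + 3 ^ i < 3 ^ j
3^-double-< {i} {j} i<j = begin-strict
  -- The third summand `x + 0` of `3 ^ suc i` is positive, hence the strictness.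
  x + x             <⟨ +-monoʳ-< x (m<m+n x (≤-trans (m^n>0 3 i) (m≤m+n x 0))) ⟩
  x + (x + (x + 0)) ≡⟨⟩
  3 ^ suc i         ≤⟨ ^-monoʳ-≤ 3 i<j ⟩
  3 ^ j             ∎
  where
  open ≤-Reasoning
  x = 3 ^ i

budget-double-< : ∀ {x} → x ∈ˢ S → budget (S - x) + budget (S - x) < budget S
budget-double-< x∈S = 3^-double-< (x∈p⇒∣p-x∣<∣p∣ x∈S)

-- S is the set of atoms not defined to the left of m.
weight : Subset n → Assignment n → ℕ
weight S []                 = budget S
weight S (propagated l ∷ m) = weight (S - atom l) m
weight S (decided l ∷ m)    = budget (S - atom l) + weight (S - atom l) m

-- Makes two transitions strict: `failure`, as `fail` measures 0, and `backtrack`, which discards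
-- the weight of `k`.
weight>0 : (S : Subset n) (m : Assignment n) → 0 < weight S m
weight>0 S []                 = budget>0 S
weight>0 S (propagated l ∷ m) = weight>0 (S - atom l) m
weight>0 S (decided l ∷ m)    =
  ≤-trans (weight>0 (S - atom l) m) (m≤n+m _ (budget (S - atom l)))

-- Entries of `m` contribute alike to both sides, so only the end of `m` matters; there the atom of
-- `a` is still in the remaining set, as no entry of `m` removed it.
weight-extend : ∀ {S : Subset n} a m → atom (literal a) ∈ˢ S →
                evalLiteral (literal a) m ≡ U → weight S (m ∷ʳ a) < weight S m
weight-extend (decided l)    [] x∈S _ = budget-double-< x∈S
weight-extend (propagated l) [] x∈S _ = ≤-<-trans (m≤m+n _ _) (budget-double-< x∈S)
weight-extend {S = S} a (b ∷ m) x∈S undef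
  with b≢a , undef′ ← undefined-∷⁻ (literal a) b m undef
  with ih ← weight-extend a m (x∈p∧x≢y⇒x∈p-y x∈S λ a≡b → b≢a (sym a≡b)) undef′
  with b
... | propagated k = ih
... | decided k    = +-monoʳ-< (budget (S - atom k)) ih

-- After `m`, both `~ l` and `l` remove the same atom, even if `m` already did, so the left side
-- ends with exactly the budget that the decision reserved.
weight-flip : ∀ (S : Subset n) m l k →
              weight S (m ∷ʳ propagated (~ l)) < weight S (m ++ decided l ∷ k)
weight-flip S [] l k rewrite atom-~ l = m<m+n (budget (S - atom l)) (weight>0 (S - atom l) k)
weight-flip S (propagated j ∷ m) l k = weight-flip (S - atom j) m l k
weight-flip S (decided j ∷ m)    l k =
  +-monoʳ-< (budget (S - atom j)) (weight-flip (S - atom j) m l k)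

measure : State n → ℕ
measure fail    = 0
measure (m ∥ f) = weight ⊤ m

⟸⇒measure< : ∀ {t s : State n} → t ⟸ s → measure t < measure s
⟸⇒measure< (unitPropagate {m = m} _ _ _ undef) = weight-extend _ m ∈⊤ undef
⟸⇒measure< (decide {m = m} _ undef) = weight-extend _ m ∈⊤ undef
⟸⇒measure< (failure {m = m} _ _ _) = weight>0 ⊤ m
⟸⇒measure< (backtrack {m = m} {l = l} {k = k} _ _ _) = weight-flip ⊤ m l k
⟸⇒measure< (pure {m = m} _ _ undef) = weight-extend _ m ∈⊤ undef

⟸-wellFounded : WellFounded (_⟸_ {n})
⟸-wellFounded = Subrelation.wellFounded ⟸⇒measure< (On.wellFounded measure <-wellFounded)

wellFounded⇒¬infiniteDescent : ∀ {a r} {A : Set a} {_≺_ : Rel A r} → WellFounded _≺_ →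
                               ¬ (∃ λ (s : ℕ → A) → InfiniteDescendingSequence _≺_ s)
wellFounded⇒¬infiniteDescent {_≺_ = _≺_} wf (s , s↓) =
  -- `P` singles out the terms of the sequence: each has its successor below it, so none is minimal.
  descent∧wf⇒empty {P = λ x → ∃ λ i → s i ≡ x}
    (λ { (i , refl) → s (suc i) , s↓ i , suc i , refl }) wf (s 0) (0 , refl)

theorem52 : (n : ℕ) →
    WellFounded (_⟸_ {n}) × ¬ (∃ λ (s : ℕ → State n) → InfiniteDescendingSequence _⟸_ s)
theorem52 n = ⟸-wellFounded , wellFounded⇒¬infiniteDescent ⟸-wellFounded
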